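{- Every weakly claw-free finite simple graph is Z-insensitive.
   Context: Graphs are finite and simple. $N(v)$ and $N[v]=N(v)\cup\{v\}$ denote the open and closed neighborhood of a vertex $v$, and $N[D]=\bigcup_{v\in D}N[v]$ for $D\subseteq V(G)$. A vertex $w$ is the center of a claw if $w$ has three pairwise non-adjacent neighbors (i.e. $w$ is the degree-$3$ vertex of an induced $K_{1,3}$). A graph $G$ is weakly claw-free if every vertex $u\in V(G)$ has a neighbor that is not the center of a claw (in particular, $G$ has no isolated vertices). For $A\subseteq V(G)$, let $G|A$ denote the partially dominated graph in which the vertices of $A$ are considered already dominated. $G|A$ has a Z-configuration if there is a vertex $v\in V(G)\setminus A$ such that $N(v)\subseteq A$ and $|N(u)\setminus A|\ge 2$ for each $u\in N(v)$. A graph $G$ without isolated vertices is Z-insensitive if for every $D\subseteq V(G)$ the partially dominated graph $G|N[D]$ has no Z-configuration. -}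

module Defs where

open import Data.Fin.Base using (Fin)
open import Data.Fin.Subset
  using (Subset; _∈_; _∉_; _⊆_; _∪_; _─_; ⋃; ⁅_⁆; ∣_∣)
open import Data.Fin.Subset.Properties using (_∈?_)
open import Data.List.Base using (allFin; filter; map)
open import Data.Nat.Base using (ℕ; _≤_)
open import Data.Product.Base using (_×_; ∃-syntax)
open import Data.Vec.Base using (tabulate)
open import Level using (0ℓ)
open import Relation.Binary.Core using (Rel)
open import Relation.Binary.Definitions using (Decidable; Irreflexive; Symmetric)
open import Relation.Binary.PropositionalEquality.Core using (_≡_; _≢_)
open import Relation.Nullary.Decidable.Core using (does)
open import Relation.Nullary.Negation.Core using (¬_)

-- A finite simple graph, with vertex set Fin n. Decidability of adjacency
-- is what lets neighbourhoods be elements of `Subset n`.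
record Graph (n : ℕ) : Set₁ where
  infix 4 _~_ _~?_
  field
    _~_      : Rel (Fin n) 0ℓ
    ~-sym    : Symmetric _~_
    ~-irrefl : Irreflexive _≡_ _~_
    _~?_     : Decidable _~_

module _ {n : ℕ} (G : Graph n) where
  open Graph G

  N : Fin n → Subset n
  N v = tabulate (λ u → does (v ~? u))

  N[_] : Fin n → Subset n
  N[_] v = N v ∪ ⁅ v ⁆

  -- The closed neighbourhood N[D] of a set of vertices.
  N[_]ˢ : Subset n → Subset n
  N[_]ˢ D = ⋃ (map N[_] (filter (_∈? D) (allFin n)))

  -- The three leaves are required to be distinct: non-adjacency alone does
  -- not imply this, as no vertex is adjacent to itself.
  IsClawCenter : Fin n → Set
  IsClawCenter w =
    ∃[ x ] ∃[ y ] ∃[ z ]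
      (x ∈ N w × y ∈ N w × z ∈ N w)
      × (x ≢ y × x ≢ z × y ≢ z)
      × (¬ x ~ y × ¬ x ~ z × ¬ y ~ z)

  WeaklyClawFree : Set
  WeaklyClawFree = ∀ u → ∃[ v ] v ∈ N u × ¬ IsClawCenter v

  NoIsolatedVertices : Set
  NoIsolatedVertices = ∀ u → ∃[ v ] v ∈ N u

  -- The partially dominated graph G|A, given by G and A, has a
  -- Z-configuration.
  HasZConfiguration : Subset n → Set
  HasZConfiguration A =
    ∃[ v ] v ∉ A × N v ⊆ A × (∀ u → u ∈ N v → 2 ≤ ∣ N u ─ A ∣)

  -- Z-insensitivity is defined only for graphs without isolated vertices, so
  -- this requirement is part of the property.
  ZInsensitive : Set
  ZInsensitive = NoIsolatedVertices × (∀ D → ¬ HasZConfiguration (N[_]ˢ D))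

{-# OPTIONS --safe #-}
-- Suppose v is undominated by D while all its neighbours are dominated, and let
-- u ∈ N(v) be a neighbour that is not a claw centre. Since v ∉ N[D], u is not in
-- D itself, so it has a neighbour d ∈ D. Any undominated neighbour w ≠ v of u
-- would make {d, v, w} the leaves of a claw at u: d is adjacent to no undominated
-- vertex, and v to no undominated vertex as N(v) ⊆ N[D]. Hence v is the only
-- undominated neighbour of u, which excludes a Z-configuration at v.
module Submission where

open import Defs
open import Data.Nat.Base using (ℕ; _≤_)
open import Data.Fin.Base using (Fin)
open import Data.Fin.Properties using (_≟_)
open import Data.Fin.Subset
  using (Subset; inside; outside; _∈_; _∉_; _⊆_; _─_; ⋃; ⁅_⁆; ∣_∣)
open import Data.Fin.Subset.Properties
  using (_∈?_; ∉⊥; x∈⁅x⁆; x∈⁅y⁆⇒x≡y; x∈p∪q⁺; x∈p∪q⁻; p─q⊆p; p⊆q⇒∣p∣≤∣q∣; ∣⁅x⁆∣≡1)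
open import Data.List.Base using (List; []; _∷_; allFin)
open import Data.List.Membership.Propositional using (find; lose)
open import Data.List.Membership.Propositional.Properties
  using (∈-allFin; ∈-map∘filter⁺; ∈-map∘filter⁻)
open import Data.List.Relation.Unary.Any using (Any; here; there)
open import Data.Nat.Properties using (<⇒≱)
open import Data.Product.Base using (_×_; _,_; map₂; proj₁; ∃-syntax)
open import Data.Sum.Base using (inj₁; inj₂)
open import Data.Vec.Base using (_∷_; here; there)
open import Data.Vec.Properties using ([]=⇒lookup; lookup⇒[]=; lookup∘tabulate)
open import Function.Base using (_∘_)
open import Relation.Binary.PropositionalEquality
  using (_≡_; refl; sym; trans; subst; ≢-sym)
open import Relation.Nullary.Decidable using (yes; no; dec-true)
open import Relation.Nullary.Negation using (¬_; contradiction)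

private
  variable
    n : ℕ
    x : Fin n

x∈p─q⇒x∉q : ∀ (p q : Subset n) → x ∈ p ─ q → x ∉ q
-- Splitting on the head of `q` lets the head of the difference compute, so it cannot lie in both
-- `p ─ q` and `q`; only the `there` cases survive.
x∈p─q⇒x∉q (_ ∷ p) (inside  ∷ q) (there x∈) (there x∈q) = x∈p─q⇒x∉q p q x∈ x∈q
x∈p─q⇒x∉q (_ ∷ p) (outside ∷ q) (there x∈) (there x∈q) = x∈p─q⇒x∉q p q x∈ x∈q

∈⋃⁺ : ∀ {ps : List (Subset n)} → Any (x ∈_) ps → x ∈ ⋃ ps
∈⋃⁺ (here x∈p)   = x∈p∪q⁺ (inj₁ x∈p)
∈⋃⁺ (there x∈ps) = x∈p∪q⁺ (inj₂ (∈⋃⁺ x∈ps))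

∈⋃⁻ : ∀ (ps : List (Subset n)) → x ∈ ⋃ ps → Any (x ∈_) ps
∈⋃⁻ []       x∈ = contradiction x∈ ∉⊥
∈⋃⁻ (p ∷ ps) x∈ with x∈p∪q⁻ p (⋃ ps) x∈
... | inj₁ x∈p  = here x∈p
... | inj₂ x∈ps = there (∈⋃⁻ ps x∈ps)

module _ (G : Graph n) where
  open Graph G

  ∈N⁺ : ∀ {u v} → v ~ u → u ∈ N G v
  ∈N⁺ {u} {v} v~u =
    lookup⇒[]= u _ (trans (lookup∘tabulate _ u) (dec-true (v ~? u) v~u))

  ∈N⁻ : ∀ {u v} → u ∈ N G v → v ~ u
  ∈N⁻ {u} {v} u∈Nv with v ~? u | trans (sym (lookup∘tabulate _ u)) ([]=⇒lookup u∈Nv)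
  -- If `v` and `u` were not adjacent, the paired equation would read `false ≡ true`.
  ... | yes v~u | _ = v~u

  ∈N[]ˢ⁺ : ∀ {D d} → d ∈ D → x ∈ N[_] G d → x ∈ N[_]ˢ G D
  ∈N[]ˢ⁺ {D = D} d∈D x∈N[d] =
    ∈⋃⁺ (lose (∈-map∘filter⁺ (N[_] G) (_∈? D) (_ , ∈-allFin _ , refl , d∈D)) x∈N[d])

  ∈N[]ˢ⁻ : ∀ {D} → x ∈ N[_]ˢ G D → ∃[ d ] d ∈ D × x ∈ N[_] G d
  ∈N[]ˢ⁻ {D = D} x∈ with find (∈⋃⁻ _ x∈)
  ... | _ , p∈ , x∈p with ∈-map∘filter⁻ (N[_] G) (_∈? D) {f = N[_] G} {xs = allFin n} p∈
  ...   | d , _ , refl , d∈D = d , d∈D , x∈p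

  ~⇒∈N[]ˢ : ∀ {D d} → d ∈ D → d ~ x → x ∈ N[_]ˢ G D
  ~⇒∈N[]ˢ d∈D d~x = ∈N[]ˢ⁺ d∈D (x∈p∪q⁺ (inj₁ (∈N⁺ d~x)))

  D⊆N[D] : ∀ {D} → D ⊆ N[_]ˢ G D
  D⊆N[D] d∈D = ∈N[]ˢ⁺ d∈D (x∈p∪q⁺ (inj₂ (x∈⁅x⁆ _)))

  dominated∧undominated-neighbour⇒dominator-neighbour :
    ∀ {D u v} → u ∈ N[_]ˢ G D → v ∉ N[_]ˢ G D → u ~ v → ∃[ d ] d ∈ D × u ~ d
  dominated∧undominated-neighbour⇒dominator-neighbour {u = u} u∈N[D] v∉N[D] u~v
    with ∈N[]ˢ⁻ u∈N[D]
  ... | d , d∈D , u∈N[d] with x∈p∪q⁻ (N G d) ⁅ d ⁆ u∈N[d]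
  ...   | inj₁ u∈Nd = d , d∈D , ~-sym (∈N⁻ u∈Nd)
  -- Now `u` itself is in `D` and would dominate `v`.
  ...   | inj₂ u∈⁅d⁆ with refl ← x∈⁅y⁆⇒x≡y d u∈⁅d⁆ =
    contradiction (~⇒∈N[]ˢ d∈D u~v) v∉N[D]

  -- Inclusion in a singleton is the form that monotonicity of cardinality turns into a bound by 1.
  unique-undominated-neighbour :
    ∀ {D u v} → v ∉ N[_]ˢ G D → N G v ⊆ N[_]ˢ G D → u ∈ N G v →
    ¬ IsClawCenter G u → N G u ─ N[_]ˢ G D ⊆ ⁅ v ⁆
  unique-undominated-neighbour {D} {u} {v} v∉N[D] Nv⊆N[D] u∈Nv ¬claw {w} w∈
    with w ≟ v
  ... | yes refl = x∈⁅x⁆ w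
  ... | no  w≢v
    with d , d∈D , u~d ← dominated∧undominated-neighbour⇒dominator-neighbour
                           (Nv⊆N[D] u∈Nv) v∉N[D] (~-sym (∈N⁻ u∈Nv)) =
    contradiction
      ( d , v , w
      , (∈N⁺ u~d , ∈N⁺ (~-sym (∈N⁻ u∈Nv)) , p─q⊆p _ _ w∈)
      -- The leaf `d` dominates itself, so it differs from the undominated `v` and `w`.
      , ((λ { refl → v∉N[D] (D⊆N[D] d∈D) }) , (λ { refl → w∉N[D] (D⊆N[D] d∈D) })
        , ≢-sym w≢v)
      , (v∉N[D] ∘ ~⇒∈N[]ˢ d∈D , w∉N[D] ∘ ~⇒∈N[]ˢ d∈D , w∉N[D] ∘ Nv⊆N[D] ∘ ∈N⁺))
      ¬claw
    where
    w∉N[D] : w ∉ N[_]ˢ G D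
    w∉N[D] = x∈p─q⇒x∉q (N G u) (N[_]ˢ G D) w∈

mainTheorem5 : (n : ℕ) (G : Graph n) → WeaklyClawFree G → ZInsensitive G
mainTheorem5 n G wcf = map₂ proj₁ ∘ wcf , noZ
  where
  noZ : ∀ D → ¬ HasZConfiguration G (N[_]ˢ G D)
  noZ D (v , v∉N[D] , Nv⊆N[D] , two) with u , u∈Nv , ¬claw ← wcf v =
    -- `2 ≤ k` unfolds to `1 < k`, which contradicts `k ≤ 1` for the number `k` of undominated
    -- neighbours of `u`.
    <⇒≱ (two u u∈Nv)
      (subst (∣ N G u ─ N[_]ˢ G D ∣ ≤_) (∣⁅x⁆∣≡1 v)
        (p⊆q⇒∣p∣≤∣q∣ (unique-undominated-neighbour G v∉N[D] Nv⊆N[D] u∈Nv ¬claw)))
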